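{- Let $F(p)=\#\{u\in\{0,\ldots,p-1\} : q_p(u)=u\}$ denote the number of fixed points of the map $u\mapsto q_p(u)$ on $\{0,\ldots,p-1\}$. Then $F(p)\ll p^{11/12+o(1)}$ as $p\to\infty$ over primes.
   Context: For a prime $p$ and an integer $u$ with $\gcd(u,p)=1$, the Fermat quotient $q_p(u)$ is the unique integer with $q_p(u)\equiv (u^{p-1}-1)/p \pmod p$ and $0\le q_p(u)\le p-1$; also $q_p(kp)=0$ for all $k\in\mathbb Z$. The notation $A\ll B$ means $|A|\le cB$ for some absolute constant $c>0$. -}

module Defs where

open import Data.Nat using (ℕ; zero; suc; _∸_; _^_; _≟_)
open import Data.Nat.DivMod using (_/_; _%_)
open import Data.Nat.Divisibility using (_∣?_)
open import Data.List using (length; filter; upTo)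
open import Relation.Nullary using (yes; no)

-- Fermat quotient q_p(u) for p ≥ 1 (written p = suc m):
--   q_p(u) = 0                                  if p ∣ u,
--   q_p(u) = ((u^(p-1) - 1) / p) mod p           otherwise.
-- For p prime and p ∤ u, p divides u^(p-1) - 1 (Fermat), so the division is
-- exact and this is the unique representative in {0,…,p-1}.
-- For p = 0 (never used) we set it to 0.
fermatQuotient : ℕ → ℕ → ℕ
fermatQuotient zero    u = 0
fermatQuotient (suc m) u with suc m ∣? u
... | yes _ = 0
... | no  _ = ((u ^ m ∸ 1) / suc m) % suc m

fixedPoints : ℕ → ℕ
fixedPoints p = length (filter (λ u → fermatQuotient p u ≟ u) (upTo p))

{-# OPTIONS --safe #-}
module Submission where

-- A fixed point u satisfies u^p ≡ u + p u² (mod p²). Suppose a u = r + p i and b v = r + p j for fixed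
-- points u, v and distinct small multipliers a, b. Then (a u)^p ≡ r^p ≡ (b v)^p (mod p²), and dividing
-- the resulting congruence by p leaves a quadratic congruence for u modulo p whose coefficients depend
-- only on a, b, i, j and whose leading coefficient a (b − a) is invertible. So each (a, b, i, j) comes
-- from at most two u, and the dilates a S mod p of the set S of fixed points, 1 ≤ a ≤ n, are nearly
-- disjoint. As they all lie in p residue classes, n |S| ≤ 2p + 2n⁴; taking n ≈ p^(1/4) yields
-- |S| ≤ 8 p^(3/4).

open import Defs
open import Data.Nat using (ℕ; zero; suc; _+_; _*_; _^_; _∸_; _≤_; _<_; z≤n; s≤s; _≟_; NonZero; ≢-nonZero; nonTrivial⇒n>1; _≤?_)
open import Data.Nat.Properties
open import Data.Nat.DivMod using (_/_; _%_; m≡m%n+[m/n]*n; m%n<n; m<n*o⇒m/o<n; m*[n/m]≡n)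
open import Data.Nat.Divisibility
open import Data.Nat.Primality using (Prime; euclidsLemma; prime⇒nonZero; prime⇒nonTrivial)
open import Data.Nat.Combinatorics using (_C_; nCn≡1; nCk+nC[k+1]≡[n+1]C[k+1]; k>n⇒nCk≡0)
open import Data.Nat.Tactic.RingSolver using (solve-∀)
open import Data.Integer as ℤ using (ℤ) renaming (+_ to pos)
import Data.Integer.Properties as ℤ
import Data.Integer.Divisibility.Signed as ℤ∣
import Data.Integer.Tactic.RingSolver as ℤSolver
open import Data.Fin using (Fin; zero; suc; toℕ; fromℕ; inject₁)
open import Data.Fin.Properties using (toℕ-fromℕ; toℕ-inject₁; toℕ<n)
open import Data.List using (List; []; _∷_; _++_; length; map; filter; upTo; cartesianProduct)
open import Data.List.Properties using (length-++; length-map; length-upTo)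
open import Data.List.Membership.Propositional using (_∈_)
open import Data.List.Membership.Propositional.Properties using (∈-filter⁻; ∈-upTo⁺; ∈-upTo⁻; ∈-cartesianProduct⁺; ∈-cartesianProduct⁻; ∈-++⁻; ∈-map⁻)
open import Data.List.Membership.DecPropositional _≟_ using (_∈?_)
open import Data.List.Relation.Unary.Any using (here; there)
open import Data.List.Relation.Unary.All using ([]; _∷_)
import Data.List.Relation.Unary.All as All
import Data.List.Relation.Unary.All.Properties as All
open import Data.List.Relation.Unary.AllPairs using ([]; _∷_)
open import Data.List.Relation.Unary.Unique.Propositional using (Unique)
import Data.List.Relation.Unary.Unique.Propositional.Properties as Unique
open import Data.Product using (∃-syntax; _×_; _,_; proj₁; proj₂)
open import Data.Sum using (_⊎_; inj₁; inj₂; [_,_]′)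
open import Data.Empty using (⊥; ⊥-elim)
open import Function using (_∘_; id)
open import Relation.Nullary using (¬_; yes; no; contradiction)
open import Relation.Nullary.Decidable using (¬?)
open import Relation.Unary using (Decidable)
open import Relation.Binary.PropositionalEquality
import Algebra.Properties.CommutativeSemiring.Binomial +-*-commutativeSemiring as Binomial
import Algebra.Properties.Semiring.Exp +-*-semiring as Exp
import Algebra.Properties.Semiring.Mult +-*-semiring as Mult
import Algebra.Properties.Semiring.Sum +-*-semiring as Sum

-- Fermat's little theorem

-- Pascal's rule reduces the entry to two entries of the previous row, where induction applies. For
-- `suc n` prime, the identity exhibits the prime as a divisor of the left-hand product.
absorption : ∀ n k → suc k * (suc n C suc k) ≡ suc n * (n C k)
absorption zero zero = refl
absorption zero (suc k)
  rewrite k>n⇒nCk≡0 {1} {suc (suc k)} (s≤s (s≤s z≤n)) | k>n⇒nCk≡0 {0} {suc k} (s≤s z≤n) | *-zeroʳ k = refl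
absorption (suc n) zero = begin
  1 * (suc (suc n) C 1)           ≡⟨ cong (1 *_) (nCk+nC[k+1]≡[n+1]C[k+1] (suc n) 0) ⟨
  1 * ((suc n C 0) + (suc n C 1)) ≡⟨ *-distribˡ-+ 1 (suc n C 0) (suc n C 1) ⟩
  1 + 1 * (suc n C 1)             ≡⟨ cong suc (absorption n 0) ⟩
  1 + suc n * 1                   ≡⟨⟩
  suc (suc n) * (suc n C 0)       ∎
  where open ≡-Reasoning
absorption (suc n) (suc k) = begin
  suc (suc k) * (suc (suc n) C suc (suc k)) ≡⟨ cong (suc (suc k) *_) (nCk+nC[k+1]≡[n+1]C[k+1] (suc n) (suc k)) ⟨
  suc (suc k) * (x + y)                     ≡⟨ expand (suc k) x y ⟩
  x + (suc k * x + suc (suc k) * y)         ≡⟨ cong (λ z → x + z) (cong₂ _+_ (absorption n k) (absorption n (suc k))) ⟩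
  x + (suc n * (n C k) + suc n * (n C suc k)) ≡⟨ cong (x +_) (*-distribˡ-+ (suc n) (n C k) (n C suc k)) ⟨
  x + suc n * ((n C k) + (n C suc k))       ≡⟨ cong (λ z → x + suc n * z) (nCk+nC[k+1]≡[n+1]C[k+1] n k) ⟩
  suc (suc n) * (suc n C suc k)             ∎
  where
  open ≡-Reasoning
  x y : ℕ
  x = suc n C suc k
  y = suc n C suc (suc k)
  expand : ∀ k x y → suc k * (x + y) ≡ x + (k * x + suc k * y)
  expand = solve-∀

-- By `absorption` the prime divides `suc k * (suc n C suc k)`, and `suc k` is positive and smaller
-- than the prime.
prime∣C : ∀ {n k} → Prime (suc n) → k < n → suc n ∣ suc n C suc k
prime∣C {n} {k} pr k<n with euclidsLemma (suc k) (suc n C suc k) pr (subst (suc n ∣_) (sym (absorption n k)) (m∣m*n (n C k)))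
... | inj₁ p∣k = contradiction p∣k (>⇒∤ (s≤s k<n))
... | inj₂ p∣C = p∣C

^-agrees : ∀ x n → x Exp.^ n ≡ x ^ n
^-agrees x zero    = refl
^-agrees x (suc n) = cong (x *_) (^-agrees x n)

×-agrees : ∀ n x → n Mult.× x ≡ n * x
×-agrees zero    x = refl
×-agrees (suc n) x = cong (x +_) (×-agrees n x)

∣-sum : ∀ {d} n (f : Fin n → ℕ) → (∀ i → d ∣ f i) → d ∣ Sum.sum f
∣-sum {d} zero    f h = d ∣0
∣-sum     (suc n) f h = ∣m∣n⇒∣m+n (h zero) (∣-sum n (f ∘ suc) (h ∘ suc))

-- In the binomial expansion only the two outer terms have coefficients prime to `p`; the sum of the
-- inner ones is `p * t`.
freshman : ∀ {p} → Prime p → ∀ x y → ∃[ t ] (x + y) ^ p ≡ y ^ p + x ^ p + p * t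
freshman {suc n} pr x y = quotient mid∣ , (begin
  (x + y) ^ suc n                             ≡⟨ ^-agrees (x + y) (suc n) ⟨
  (x + y) Exp.^ suc n                         ≡⟨ Binomial.theorem (suc n) x y ⟩
  term zero + Sum.sum (term ∘ suc)            ≡⟨ cong (term zero +_) (Sum.sum-init-last (term ∘ suc)) ⟩
  term zero + (mid + term (fromℕ (suc n)))    ≡⟨ cong₂ (λ a b → a + (mid + b)) first last ⟩
  y ^ suc n + (mid + x ^ suc n)               ≡⟨ cong (λ z → y ^ suc n + (z + x ^ suc n)) (_∣_.equality mid∣) ⟩
  y ^ suc n + (quotient mid∣ * suc n + x ^ suc n) ≡⟨ shuffle (y ^ suc n) (quotient mid∣) (suc n) (x ^ suc n) ⟩
  y ^ suc n + x ^ suc n + suc n * quotient mid∣ ∎)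
  where
  open ≡-Reasoning
  term : Fin (suc (suc n)) → ℕ
  term = Binomial.binomialTerm x y (suc n)
  mid : ℕ
  mid = Sum.sum (λ i → term (suc (inject₁ i)))
  mid∣ : suc n ∣ mid
  mid∣ = ∣-sum n _ λ i → subst (suc n ∣_)
    (sym (×-agrees (suc n C suc (toℕ (inject₁ i))) (Binomial.binomial x y (suc n) (suc (inject₁ i)))))
    (∣m⇒∣m*n (Binomial.binomial x y (suc n) (suc (inject₁ i))) (subst (λ k → suc n ∣ suc n C suc k) (sym (toℕ-inject₁ i)) (prime∣C pr (toℕ<n i))))
  first : term zero ≡ y ^ suc n
  first = trans (×-agrees 1 (1 * y Exp.^ suc n)) (trans (*-identityˡ (1 * y Exp.^ suc n))
    (trans (*-identityˡ (y Exp.^ suc n)) (^-agrees y (suc n))))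
  last : term (fromℕ (suc n)) ≡ x ^ suc n
  last rewrite toℕ-fromℕ n | nCn≡1 (suc n) | n∸n≡0 n =
    trans (+-identityʳ _) (trans (*-identityʳ _) (^-agrees x (suc n)))
  shuffle : ∀ a q p b → a + (q * p + b) ≡ a + b + p * q
  shuffle = solve-∀

-- Induction on `a` through `freshman`. The witness `c` matters later: it enters the linear
-- coefficient of the collision quadratic.
fermat : ∀ {p} → Prime p → ∀ a → ∃[ c ] a ^ p ≡ a + p * c
fermat {suc n} pr zero = 0 , sym (*-zeroʳ (suc n))
fermat {p} pr (suc a) with fermat pr a | freshman pr 1 a
... | c , eq | t , eq′ = c + t , (begin
  suc a ^ p                ≡⟨ eq′ ⟩
  a ^ p + 1 ^ p + p * t    ≡⟨ cong₂ (λ x y → x + y + p * t) eq (^-zeroˡ p) ⟩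
  a + p * c + 1 + p * t    ≡⟨ shuffle a p c t ⟩
  suc a + p * (c + t)      ∎)
  where
  open ≡-Reasoning
  shuffle : ∀ a p c t → a + p * c + 1 + p * t ≡ suc a + p * (c + t)
  shuffle = solve-∀

-- Powers modulo p²

-- The binomial expansion cut off after the linear term, with all higher terms collected in
-- `p * p * s`.
power-shift : ∀ p y t n → ∃[ s ] (y + p * t) ^ suc n ≡ y ^ suc n + suc n * (p * (t * y ^ n)) + p * p * s
power-shift p y t zero = 0 , base p y t
  where
  base : ∀ p y t → (y + p * t) * 1 ≡ y * 1 + (p * (t * 1) + 0) + p * p * 0
  base = solve-∀
power-shift p y t (suc n) with power-shift p y t n
... | s , eq = suc n * (t * (t * y ^ n)) + y * s + p * t * s
             , trans (cong ((y + p * t) *_) eq) (step p y t (suc n) (y ^ n) s)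
  where
  step : ∀ p y t n z s → (y + p * t) * (y * z + n * (p * (t * z)) + p * p * s)
       ≡ y * (y * z) + suc n * (p * (t * (y * z))) + p * p * (n * (t * (t * z)) + y * s + p * t * s)
  step = solve-∀

-- For exponent `p` the linear term of `power-shift` gains a second factor `p`, so a `p`-th power
-- modulo p² depends only on the base modulo `p`.
pth-power-shift : ∀ p .{{_ : NonZero p}} y t → ∃[ s ] (y + p * t) ^ p ≡ y ^ p + p * p * s
pth-power-shift p@(suc n) y t with power-shift p y t n
... | s , eq = t * y ^ n + s , trans eq (shuffle (y ^ p) p (t * y ^ n) s)
  where
  shuffle : ∀ z p w s → z + p * (p * w) + p * p * s ≡ z + p * p * (w + s)
  shuffle = solve-∀

-- Away from multiples of `p`, u^(p-1) = 1 + p d, and being fixed means d ≡ u (mod p); multiplying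
-- by `u` gives the expansion.
fixed-power : ∀ {p} → Prime p → ∀ {u} → u < p → fermatQuotient p u ≡ u →
  ∃[ s ] u ^ p ≡ u + p * (u * u) + p * p * s
fixed-power {p@(suc m)} pr {u} u<p fix with p ∣? u
-- Here the quotient takes its default value 0, so a fixed point must be 0.
... | yes _ rewrite sym fix = 0 , zeros p
  where
  zeros : ∀ p → 0 ≡ p * 0 + p * p * 0
  zeros = solve-∀
... | no p∤u = u * (d / p) , (begin
  u * u ^ m                            ≡⟨ cong (u *_) (m+[n∸m]≡n 1≤u^m) ⟨
  u * (1 + (u ^ m ∸ 1))                ≡⟨ cong (λ z → u * (1 + z)) (m*[n/m]≡n p∣) ⟨
  u * (1 + p * d)                      ≡⟨ cong (λ z → u * (1 + p * z)) (trans (m≡m%n+[m/n]*n d p) (cong (_+ d / p * p) fix)) ⟩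
  u * (1 + p * (u + d / p * p))        ≡⟨ expand u p (d / p) ⟩
  u + p * (u * u) + p * p * (u * (d / p)) ∎)
  where
  open ≡-Reasoning
  d : ℕ
  d = (u ^ m ∸ 1) / p
  u≢0 : u ≢ 0
  u≢0 u≡0 = p∤u (subst (p ∣_) (sym u≡0) (p ∣0))
  1≤u^m : 1 ≤ u ^ m
  1≤u^m = m^n>0 u {{≢-nonZero u≢0}} m
  -- Fermat's theorem is available for `u ^ p`, so the extra factor `u` is removed afterwards by
  -- Euclid's lemma.
  p∣u*[u^m-1] : p ∣ u * (u ^ m ∸ 1)
  p∣u*[u^m-1] with fermat pr u
  ... | c , eq = subst (p ∣_) (sym (begin
    u * (u ^ m ∸ 1)     ≡⟨ *-distribˡ-∸ u (u ^ m) 1 ⟩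
    u ^ p ∸ u * 1       ≡⟨ cong₂ _∸_ eq (*-identityʳ u) ⟩
    u + p * c ∸ u       ≡⟨ m+n∸m≡n u (p * c) ⟩
    p * c               ∎)) (m∣m*n c)
  p∣ : p ∣ u ^ m ∸ 1
  p∣ with euclidsLemma u (u ^ m ∸ 1) pr p∣u*[u^m-1]
  ... | inj₁ p∣u = contradiction p∣u p∤u
  ... | inj₂ p∣v = p∣v
  expand : ∀ u p e → u * (1 + p * (u + e * p)) ≡ u + p * (u * u) + p * p * (u * e)
  expand = solve-∀

-- Roots of quadratics modulo p

euclidℤ : ∀ {p} → Prime p → ∀ x y → pos p ℤ∣.∣ x ℤ.* y → pos p ℤ∣.∣ x ⊎ pos p ℤ∣.∣ y
euclidℤ {p} pr x y d with euclidsLemma ℤ.∣ x ∣ ℤ.∣ y ∣ pr (subst (p ∣_) (ℤ.abs-* x y) (ℤ∣.∣⇒∣ᵤ d))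
... | inj₁ h = inj₁ (ℤ∣.∣ᵤ⇒∣ h)
... | inj₂ h = inj₂ (ℤ∣.∣ᵤ⇒∣ h)

-- The absolute difference is at most the larger of the two numbers, hence below `p`, and the only
-- multiple of `p` in that range is 0.
∣-difference⇒≡ : ∀ {p u v} → u < p → v < p → pos p ℤ∣.∣ pos u ℤ.- pos v → u ≡ v
∣-difference⇒≡ {p} {u} {v} u<p v<p d =
  ℤ.+-injective (ℤ.i-j≡0⇒i≡j (pos u) (pos v) (ℤ.∣i∣≡0⇒i≡0 (small (ℤ∣.∣⇒∣ᵤ d) abs<p)))
  where
  abs<p : ℤ.∣ pos u ℤ.- pos v ∣ < p
  abs<p = subst (λ z → ℤ.∣ z ∣ < p) (sym (ℤ.m-n≡m⊖n u v)) (≤-<-trans (ℤ.∣m⊝n∣≤m⊔n u v) (⊔-lub u<p v<p))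
  small : ∀ {n} → p ∣ n → n < p → n ≡ 0
  small {zero}  _ _   = refl
  small {suc _} h n<p = contradiction h (>⇒∤ n<p)

offset-congruence : ∀ p m n x y → m + p * x ≡ n + p * y → pos p ℤ∣.∣ pos m ℤ.- pos n
offset-congruence p m n x y eq = ℤ∣.divides (pos y ℤ.- pos x) (begin
  pos m ℤ.- pos n                                     ≡⟨ insert (pos m) (pos n) (pos p) (pos x) ⟩
  (pos m ℤ.+ pos p ℤ.* pos x) ℤ.- pos n ℤ.- pos p ℤ.* pos x ≡⟨ cong (λ z → z ℤ.- pos n ℤ.- pos p ℤ.* pos x) eqℤ ⟩
  (pos n ℤ.+ pos p ℤ.* pos y) ℤ.- pos n ℤ.- pos p ℤ.* pos x ≡⟨ collect (pos n) (pos p) (pos x) (pos y) ⟩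
  (pos y ℤ.- pos x) ℤ.* pos p                         ∎)
  where
  open ≡-Reasoning
  eqℤ : pos m ℤ.+ pos p ℤ.* pos x ≡ pos n ℤ.+ pos p ℤ.* pos y
  eqℤ = begin
    pos m ℤ.+ pos p ℤ.* pos x ≡⟨ cong (λ z → pos m ℤ.+ z) (ℤ.pos-* p x) ⟨
    pos (m + p * x)           ≡⟨ cong pos eq ⟩
    pos (n + p * y)           ≡⟨ cong (λ z → pos n ℤ.+ z) (ℤ.pos-* p y) ⟩
    pos n ℤ.+ pos p ℤ.* pos y ∎
  insert : ∀ m n p x → m ℤ.- n ≡ (m ℤ.+ p ℤ.* x) ℤ.- n ℤ.- p ℤ.* x
  insert = ℤSolver.solve-∀
  collect : ∀ n p x y → (n ℤ.+ p ℤ.* y) ℤ.- n ℤ.- p ℤ.* x ≡ (y ℤ.- x) ℤ.* p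
  collect = ℤSolver.solve-∀

quadratic : (α β γ : ℤ) → ℕ → ℤ
quadratic α β γ u = α ℤ.* (pos u ℤ.* pos u) ℤ.+ β ℤ.* pos u ℤ.+ γ

-- Subtracting the values at two roots u, x and cancelling u - x leaves α (u + x) + β ≡ 0. Doing
-- this for x = v and x = w and subtracting again leaves α (v - w) ≡ 0.
no-three-roots : ∀ {p} → Prime p → ∀ {α} β γ → ¬ pos p ℤ∣.∣ α → ∀ {u v w} → u < p → v < p → w < p →
  pos p ℤ∣.∣ quadratic α β γ u → pos p ℤ∣.∣ quadratic α β γ v → pos p ℤ∣.∣ quadratic α β γ w →
  u ≢ v → u ≢ w → v ≢ w → ⊥
no-three-roots {p} pr {α} β γ p∤α {u} {v} {w} u<p v<p w<p du dv dw u≢v u≢w v≢w =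
  [ p∤α , v≢w ∘ ∣-difference⇒≡ v<p w<p ]′ (euclidℤ pr α (pos v ℤ.- pos w)
    (subst (pos p ℤ∣.∣_) (subtract α β (pos u) (pos v) (pos w))
      (ℤ∣.∣m∣n⇒∣m-n (root-sum v<p dv u≢v) (root-sum w<p dw u≢w))))
  where
  factor : ∀ α β γ u v → (α ℤ.* (u ℤ.* u) ℤ.+ β ℤ.* u ℤ.+ γ) ℤ.- (α ℤ.* (v ℤ.* v) ℤ.+ β ℤ.* v ℤ.+ γ)
         ≡ (u ℤ.- v) ℤ.* (α ℤ.* (u ℤ.+ v) ℤ.+ β)
  factor = ℤSolver.solve-∀
  subtract : ∀ α β u v w → (α ℤ.* (u ℤ.+ v) ℤ.+ β) ℤ.- (α ℤ.* (u ℤ.+ w) ℤ.+ β) ≡ α ℤ.* (v ℤ.- w)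
  subtract = ℤSolver.solve-∀
  root-sum : ∀ {x} → x < p → pos p ℤ∣.∣ quadratic α β γ x → u ≢ x → pos p ℤ∣.∣ α ℤ.* (pos u ℤ.+ pos x) ℤ.+ β
  root-sum {x} x<p dx u≢x =
    [ (λ h → contradiction (∣-difference⇒≡ u<p x<p h) u≢x) , id ]′ (euclidℤ pr (pos u ℤ.- pos x) _
      (subst (pos p ℤ∣.∣_) (factor α β γ (pos u) (pos x)) (ℤ∣.∣m∣n⇒∣m-n du dx)))

-- Collisions a u ≡ b v (mod p) between fixed points u and v

leading : ℕ → ℕ → ℤ
leading a b = pos a ℤ.* (pos b ℤ.- pos a)

p∤leading : ∀ {p} → Prime p → ∀ {a b} → 0 < a → a < p → b < p → a ≢ b → ¬ pos p ℤ∣.∣ leading a b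
p∤leading {p@(suc _)} pr {a} {b} 0<a a<p b<p a≢b d with euclidℤ pr (pos a) (pos b ℤ.- pos a) d
-- Reading `a` as a - 0 lets the difference lemma force `a` to be 0.
... | inj₁ h = <⇒≢ 0<a (sym (∣-difference⇒≡ a<p (s≤s z≤n) (subst (pos p ℤ∣.∣_) (sym (ℤ.+-identityʳ (pos a))) h)))
... | inj₂ h = a≢b (sym (∣-difference⇒≡ b<p a<p h))

*-^-distrib : ∀ a b n → (a * b) ^ n ≡ a ^ n * b ^ n
*-^-distrib a b zero    = refl
*-^-distrib a b (suc n) = trans (cong (a * b *_) (*-^-distrib a b n)) ([m*n]*[o*p]≡[m*o]*[n*p] a b (a ^ n) (b ^ n))

-- Both (a u)^p and (b v)^p are congruent to r^p modulo p². Comparing the terms of order `p` gives i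
-- + a u² + c u ≡ j + b v² + d v (mod p). Multiplying by `b` and replacing b v by a u eliminates
-- `v`.
collision : ∀ {p} → Prime p → ∀ {a b u v r i j c d s t} →
  a ^ p ≡ a + p * c → b ^ p ≡ b + p * d →
  u ^ p ≡ u + p * (u * u) + p * p * s → v ^ p ≡ v + p * (v * v) + p * p * t →
  a * u ≡ r + p * i → b * v ≡ r + p * j →
  pos p ℤ∣.∣ quadratic (leading a b) (pos b ℤ.* pos c ℤ.- pos d ℤ.* pos a) (pos b ℤ.* (pos i ℤ.- pos j)) u
collision {p} pr {a} {b} {u} {v} {r} {i} {j} {c} {d} {s} {t} ha hb hu hv hau hbv =
  subst (pos p ℤ∣.∣_) (assemble (pos a) (pos b) (pos c) (pos d) (pos i) (pos j) (pos u) (pos v))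
    (ℤ∣.∣m∣n⇒∣m+n (ℤ∣.∣n⇒∣m*n (pos b) p∣first) (ℤ∣.∣m⇒∣m*n _ p∣bv-au))
  where
  instance _ = prime⇒nonZero pr
  -- One computation serves both (a, u) and (b, v): it expands the `p`-th power of the product and
  -- keeps the order-p² errors as `x` and `y`.
  side : ∀ {a u r i c s} → a ^ p ≡ a + p * c → u ^ p ≡ u + p * (u * u) + p * p * s → a * u ≡ r + p * i →
    ∃[ x ] ∃[ y ] r + p * (i + a * (u * u) + c * u + p * x) ≡ r ^ p + p * p * y
  side {a} {u} {r} {i} {c} {s} ha hu hau with pth-power-shift p r i
  ... | y , eq = a * s + c * (u * u) + p * c * s , y , (begin
    r + p * (i + a * (u * u) + c * u + p * x)               ≡⟨ shuffle r p i (a * (u * u)) (c * u) x ⟩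
    (r + p * i) + p * (a * (u * u) + c * u + p * x)         ≡⟨ cong (_+ p * (a * (u * u) + c * u + p * x)) hau ⟨
    a * u + p * (a * (u * u) + c * u + p * x)               ≡⟨ expand a u p c s ⟨
    (a + p * c) * (u + p * (u * u) + p * p * s)             ≡⟨ cong₂ _*_ ha hu ⟨
    a ^ p * u ^ p                                           ≡⟨ *-^-distrib a u p ⟨
    (a * u) ^ p                                             ≡⟨ cong (_^ p) hau ⟩
    (r + p * i) ^ p                                         ≡⟨ eq ⟩
    r ^ p + p * p * y                                       ∎)
    where
    open ≡-Reasoning
    x : ℕ
    x = a * s + c * (u * u) + p * c * s
    shuffle : ∀ r p i z w x → r + p * (i + z + w + p * x) ≡ (r + p * i) + p * (z + w + p * x)
    shuffle = solve-∀
    expand : ∀ a u p c s → (a + p * c) * (u + p * (u * u) + p * p * s)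
           ≡ a * u + p * (a * (u * u) + c * u + p * (a * s + c * (u * u) + p * c * s))
    expand = solve-∀
  p∣first : pos p ℤ∣.∣ pos i ℤ.+ pos a ℤ.* (pos u ℤ.* pos u) ℤ.+ pos c ℤ.* pos u
                   ℤ.- (pos j ℤ.+ pos b ℤ.* (pos v ℤ.* pos v) ℤ.+ pos d ℤ.* pos v)
  -- To stay within natural numbers, each equation receives the p² error of the other; the
  -- right-hand sides then agree, and `r` and one factor `p` cancel.
  p∣first with side {a} {u} {r} {i} {c} {s} ha hu hau | side {b} {v} {r} {j} {d} {t} hb hv hbv
  ... | x , y , e | x′ , y′ , e′ = subst (pos p ℤ∣.∣_) (cong₂ ℤ._-_ (cast i a u c) (cast j b v d))
    (offset-congruence p m n (x + y′) (x′ + y) (*-cancelˡ-≡ _ _ p (+-cancelˡ-≡ r _ _ (begin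
      r + p * (m + p * (x + y′))           ≡⟨ shuffle r p m x y′ ⟩
      r + p * (m + p * x) + p * p * y′     ≡⟨ cong (_+ p * p * y′) e ⟩
      r ^ p + p * p * y + p * p * y′       ≡⟨ swap (r ^ p) (p * p * y) (p * p * y′) ⟩
      r ^ p + p * p * y′ + p * p * y       ≡⟨ cong (_+ p * p * y) e′ ⟨
      r + p * (n + p * x′) + p * p * y     ≡⟨ shuffle r p n x′ y ⟨
      r + p * (n + p * (x′ + y))           ∎))))
    where
    open ≡-Reasoning
    m n : ℕ
    m = i + a * (u * u) + c * u
    n = j + b * (v * v) + d * v
    shuffle : ∀ r p m x y → r + p * (m + p * (x + y)) ≡ r + p * (m + p * x) + p * p * y
    shuffle = solve-∀
    swap : ∀ x y z → x + y + z ≡ x + z + y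
    swap = solve-∀
    cast : ∀ i a u c → pos (i + a * (u * u) + c * u) ≡ pos i ℤ.+ pos a ℤ.* (pos u ℤ.* pos u) ℤ.+ pos c ℤ.* pos u
    cast i a u c = cong₂ (λ x y → pos i ℤ.+ x ℤ.+ y)
      (trans (ℤ.pos-* a (u * u)) (cong (λ z → pos a ℤ.* z) (ℤ.pos-* u u))) (ℤ.pos-* c u)
  p∣bv-au : pos p ℤ∣.∣ pos b ℤ.* pos v ℤ.- pos a ℤ.* pos u
  p∣bv-au = subst (pos p ℤ∣.∣_) (cong₂ ℤ._-_ (ℤ.pos-* b v) (ℤ.pos-* a u))
    (offset-congruence p (b * v) (a * u) i j (begin
      b * v + p * i       ≡⟨ cong (_+ p * i) hbv ⟩
      r + p * j + p * i   ≡⟨ swap r (p * j) (p * i) ⟩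
      r + p * i + p * j   ≡⟨ cong (_+ p * j) hau ⟨
      a * u + p * j       ∎))
    where
    open ≡-Reasoning
    swap : ∀ x y z → x + y + z ≡ x + z + y
    swap = solve-∀
  -- The second summand is (b v)² - (a u)² + d (b v - a u) in factored form: the cost of replacing b
  -- v by a u.
  assemble : ∀ a b c d i j u v →
    b ℤ.* (i ℤ.+ a ℤ.* (u ℤ.* u) ℤ.+ c ℤ.* u ℤ.- (j ℤ.+ b ℤ.* (v ℤ.* v) ℤ.+ d ℤ.* v))
      ℤ.+ (b ℤ.* v ℤ.- a ℤ.* u) ℤ.* (b ℤ.* v ℤ.+ a ℤ.* u ℤ.+ d)
    ≡ a ℤ.* (b ℤ.- a) ℤ.* (u ℤ.* u) ℤ.+ (b ℤ.* c ℤ.- d ℤ.* a) ℤ.* u ℤ.+ b ℤ.* (i ℤ.- j)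
  assemble = ℤSolver.solve-∀

-- Counting

length-filter-split : ∀ {X : Set} {P : X → Set} (P? : Decidable P) xs →
  length (filter P? xs) + length (filter (¬? ∘ P?) xs) ≡ length xs
length-filter-split P? [] = refl
length-filter-split P? (x ∷ xs) with P? x
... | yes _ = cong suc (length-filter-split P? xs)
... | no  _ = trans (+-suc _ _) (cong suc (length-filter-split P? xs))

NoThreeDistinct : ∀ {X : Set} → (X → Set) → Set
NoThreeDistinct P = ∀ {x y z} → P x → P y → P z → x ≢ y → x ≢ z → y ≢ z → ⊥

length≤2 : ∀ {X : Set} {xs : List X} → Unique xs → NoThreeDistinct (_∈ xs) → length xs ≤ 2
length≤2 {xs = []}              _ _ = z≤n
length≤2 {xs = _ ∷ []}          _ _ = s≤s z≤n
length≤2 {xs = _ ∷ _ ∷ []}      _ _ = s≤s (s≤s z≤n)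
length≤2 {xs = _ ∷ _ ∷ _ ∷ _} ((x≢y ∷ x≢z ∷ _) ∷ (y≢z ∷ _) ∷ _) no-three =
  ⊥-elim (no-three (here refl) (there (here refl)) (there (there (here refl))) x≢y x≢z y≢z)

-- Induction on the labels `ys`: the elements related to the first label number at most two and are
-- filtered out, and the others are covered by the remaining labels.
length≤fibres : ∀ {X Y : Set} {R : Y → X → Set} (R? : ∀ y → Decidable (R y)) (ys : List Y) (xs : List X) →
  Unique xs → (∀ {x} → x ∈ xs → ∃[ y ] y ∈ ys × R y x) →
  (∀ {y} → y ∈ ys → NoThreeDistinct (λ x → x ∈ xs × R y x)) →
  length xs ≤ length ys * 2
length≤fibres R? [] [] _ _ _ = z≤n
length≤fibres R? [] (x ∷ xs) _ covered _ with covered (here refl)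
... | _ , () , _
length≤fibres {X} {Y} {R} R? (y ∷ ys) xs unique covered fibres = begin
  length xs                          ≡⟨ length-filter-split (R? y) xs ⟨
  length (filter (R? y) xs) + length rest
    ≤⟨ +-mono-≤ (length≤2 (Unique.filter⁺ (R? y) unique)
                  (λ a b c → fibres (here refl) (∈-filter⁻ (R? y) a) (∈-filter⁻ (R? y) b) (∈-filter⁻ (R? y) c)))
                (length≤fibres R? ys rest (Unique.filter⁺ (¬? ∘ R? y) unique) covered′
                  (λ y∈ a b c → fibres (there y∈) (weaken a) (weaken b) (weaken c))) ⟩
  2 + length ys * 2                  ∎
  where
  open ≤-Reasoning
  rest : List X
  rest = filter (¬? ∘ R? y) xs
  covered′ : ∀ {x} → x ∈ rest → ∃[ z ] z ∈ ys × R z x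
  covered′ x∈ with ∈-filter⁻ (¬? ∘ R? y) x∈
  ... | x∈xs , ¬Ryx with covered x∈xs
  ... | z , here refl , Rzx = contradiction Rzx ¬Ryx
  ... | z , there z∈ , Rzx = z , z∈ , Rzx
  weaken : ∀ {x z} → x ∈ rest × R z x → x ∈ xs × R z x
  weaken (x∈ , r) = proj₁ (∈-filter⁻ (¬? ∘ R? y) x∈) , r

-- Each value is its own label, so fibres are singletons; the general fibre bound of two costs only
-- a factor 2 in the constant.
length≤2n : ∀ {n xs} → Unique xs → (∀ {x} → x ∈ xs → x < n) → length xs ≤ n * 2
length≤2n {n} {xs} unique bounded = subst (λ m → length xs ≤ m * 2) (length-upTo n)
  (length≤fibres (λ y x → x ≟ y) (upTo n) xs unique (λ {x} x∈ → x , ∈-upTo⁺ (bounded x∈) , refl)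
    (λ _ (_ , x≡) (_ , y≡) _ x≢y _ _ → x≢y (trans x≡ (sym y≡))))

length-cartesianProduct : ∀ {X Y : Set} (xs : List X) (ys : List Y) →
  length (cartesianProduct xs ys) ≡ length xs * length ys
length-cartesianProduct []       ys = refl
length-cartesianProduct (x ∷ xs) ys = trans (length-++ (map (x ,_) ys))
  (cong₂ _+_ (length-map (x ,_) ys) (length-cartesianProduct xs ys))

-- Injectivity is asked only on the list itself, because dilation modulo `p` is injective only on
-- numbers below `p`.
map-unique : ∀ {X Y : Set} (f : X → Y) {xs} → (∀ {x y} → x ∈ xs → y ∈ xs → f x ≡ f y → x ≡ y) →
  Unique xs → Unique (map f xs)
map-unique f inj []       = []
map-unique f inj (x∉ ∷ u) =
  All.map⁺ (All.tabulate λ y∈ fx≡fy → All.lookup x∉ y∈ (inj (here refl) (there y∈) fx≡fy))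
  ∷ map-unique f (λ a b → inj (there a) (there b)) u

-- Unions of nearly disjoint images

module _ {X : Set} (f : ℕ → X → ℕ) (S : List X) (S! : Unique S) where

  InImage : ℕ → ℕ → Set
  InImage a r = ∃[ b ] b < a × ∃[ x ] x ∈ S × r ≡ f b x

  -- Each image f a S loses at most K elements to the earlier ones.
  union-of-images : ∀ K n →
    (∀ {a x y} → a < n → x ∈ S → y ∈ S → f a x ≡ f a y → x ≡ y) →
    (∀ {a ys} → a < n → Unique ys → (∀ {y} → y ∈ ys → y ∈ S × InImage a (f a y)) → length ys ≤ K) →
    ∃[ U ] Unique U × (∀ {r} → r ∈ U → InImage n r) × n * length S ≤ length U + n * K
  union-of-images K zero    inj few = [] , [] , (λ ()) , z≤n
  union-of-images K (suc n) inj few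
    with union-of-images K n (inj ∘ m<n⇒m<1+n) (few ∘ m<n⇒m<1+n)
  ... | U , U! , U⊆ , bound = U ++ map (f n) new
    , Unique.++⁺ U! new! disjoint , image , (begin
        length S + n * length S                          ≡⟨ cong (_+ n * length S) (length-filter-split old? S) ⟨
        length (filter old? S) + length new + n * length S
          ≤⟨ +-mono-≤ (+-monoˡ-≤ (length new) (few (n<1+n n) (Unique.filter⁺ old? S!) old-image)) bound ⟩
        K + length new + (length U + n * K)              ≡⟨ shuffle K (length new) (length U) (n * K) ⟩
        length U + length new + (K + n * K)              ≡⟨ cong (λ l → length U + l + (K + n * K)) (length-map (f n) new) ⟨
        length U + length (map (f n) new) + (K + n * K)  ≡⟨ cong (_+ (K + n * K)) (length-++ U) ⟨
        length (U ++ map (f n) new) + suc n * K          ∎)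
    where
    open ≤-Reasoning
    old? : Decidable (λ x → f n x ∈ U)
    old? x = f n x ∈? U
    -- Appending only images absent from `U` keeps the union free of duplicates; the elements left
    -- out are those that `few` bounds by `K`.
    new : List X
    new = filter (¬? ∘ old?) S
    new! : Unique (map (f n) new)
    new! = map-unique (f n) (λ x∈ y∈ → inj (n<1+n n) (proj₁ (∈-filter⁻ (¬? ∘ old?) x∈)) (proj₁ (∈-filter⁻ (¬? ∘ old?) y∈)))
             (Unique.filter⁺ (¬? ∘ old?) S!)
    disjoint : ∀ {r} → ¬ (r ∈ U × r ∈ map (f n) new)
    disjoint (r∈U , r∈new) with ∈-map⁻ (f n) r∈new
    ... | x , x∈ , refl = proj₂ (∈-filter⁻ (¬? ∘ old?) {xs = S} x∈) r∈U
    image : ∀ {r} → r ∈ U ++ map (f n) new → InImage (suc n) r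
    image r∈ with ∈-++⁻ U r∈
    ... | inj₁ r∈U with U⊆ r∈U
    ...   | b , b<n , x = b , m<n⇒m<1+n b<n , x
    image r∈ | inj₂ r∈new with ∈-map⁻ (f n) r∈new
    ...   | x , x∈ , eq = n , n<1+n n , x , proj₁ (∈-filter⁻ (¬? ∘ old?) x∈) , eq
    old-image : ∀ {y} → y ∈ filter old? S → y ∈ S × InImage n (f n y)
    old-image y∈ with ∈-filter⁻ old? y∈
    ... | y∈S , fy∈U = y∈S , U⊆ fy∈U
    shuffle : ∀ a b c d → a + b + (c + d) ≡ c + b + (a + d)
    shuffle = solve-∀

-- The bound for fixed points

module _ {p} (pr : Prime p) where

  private instance
    p≢0 : NonZero p
    p≢0 = prime⇒nonZero pr

  fixed : List ℕ
  fixed = filter (λ u → fermatQuotient p u ≟ u) (upTo p)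

  fixed⇒< : ∀ {u} → u ∈ fixed → u < p
  fixed⇒< u∈ = ∈-upTo⁻ (proj₁ (∈-filter⁻ (λ u → fermatQuotient p u ≟ u) {xs = upTo p} u∈))

  fixed⇒power : ∀ {u} → u ∈ fixed → ∃[ s ] u ^ p ≡ u + p * (u * u) + p * p * s
  fixed⇒power u∈ = fixed-power pr (fixed⇒< u∈) (proj₂ (∈-filter⁻ (λ u → fermatQuotient p u ≟ u) {xs = upTo p} u∈))

  fixed! : Unique fixed
  fixed! = Unique.filter⁺ _ (Unique.upTo⁺ p)

  -- The shift to `suc a` makes the indices below `n` correspond to the multipliers 1, ..., n,
  -- avoiding multiplication by 0.
  dilate : ℕ → ℕ → ℕ
  dilate a u = suc a * u % p

  dilate-division : ∀ a u → suc a * u ≡ dilate a u + p * (suc a * u / p)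
  dilate-division a u = trans (m≡m%n+[m/n]*n (suc a * u) p) (cong (dilate a u +_) (*-comm (suc a * u / p) p))

  dilate-injective : ∀ {a u v} → suc a < p → u < p → v < p → dilate a u ≡ dilate a v → u ≡ v
  dilate-injective {a} {u} {v} a<p u<p v<p eq =
    case-euclid (euclidℤ pr (pos (suc a)) (pos u ℤ.- pos v) (subst (pos p ℤ∣.∣_) factor
      (offset-congruence p (suc a * u) (suc a * v) (suc a * v / p) (suc a * u / p) (begin
        suc a * u + p * (suc a * v / p)                               ≡⟨ cong (_+ p * (suc a * v / p)) (dilate-division a u) ⟩
        dilate a u + p * (suc a * u / p) + p * (suc a * v / p)        ≡⟨ cong (λ r → r + p * (suc a * u / p) + p * (suc a * v / p)) eq ⟩
        dilate a v + p * (suc a * u / p) + p * (suc a * v / p)        ≡⟨ swap (dilate a v) (p * (suc a * u / p)) (p * (suc a * v / p)) ⟩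
        dilate a v + p * (suc a * v / p) + p * (suc a * u / p)        ≡⟨ cong (_+ p * (suc a * u / p)) (dilate-division a v) ⟨
        suc a * v + p * (suc a * u / p)                               ∎))))
    where
    open ≡-Reasoning
    swap : ∀ x y z → x + y + z ≡ x + z + y
    swap = solve-∀
    factor : pos (suc a * u) ℤ.- pos (suc a * v) ≡ pos (suc a) ℤ.* (pos u ℤ.- pos v)
    factor = trans (cong₂ ℤ._-_ (ℤ.pos-* (suc a) u) (ℤ.pos-* (suc a) v)) (distrib (pos (suc a)) (pos u) (pos v))
      where
      distrib : ∀ a u v → a ℤ.* u ℤ.- a ℤ.* v ≡ a ℤ.* (u ℤ.- v)
      distrib = ℤSolver.solve-∀
    case-euclid : pos p ℤ∣.∣ pos (suc a) ⊎ pos p ℤ∣.∣ pos u ℤ.- pos v → u ≡ v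
    case-euclid (inj₁ h) = contradiction (ℤ∣.∣⇒∣ᵤ h) (>⇒∤ a<p)
    case-euclid (inj₂ h) = ∣-difference⇒≡ u<p v<p h

  -- The Fermat witnesses are functions of the multipliers alone, so this coefficient does not vary
  -- with the colliding points.
  middle : ℕ → ℕ → ℤ
  middle a b = pos b ℤ.* pos (proj₁ (fermat pr a)) ℤ.- pos (proj₁ (fermat pr b)) ℤ.* pos a

  -- i and j are the integer quotients of suc a * u and suc b * v by p.
  collisionRoot : ℕ → ℕ × ℕ × ℕ → ℕ → Set
  collisionRoot a (b , i , j) u = pos p ℤ∣.∣ quadratic (leading (suc a) (suc b)) (middle (suc a) (suc b))
    (pos (suc b) ℤ.* (pos i ℤ.- pos j)) u

  -- Each collision is labelled by the earlier index `b` and the quotients `i`, `j`. There are a n²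
  -- labels, and each fixes a quadratic with at most two roots below `p`.
  few-collisions : ∀ {n a us} → n < p → a < n → Unique us →
    (∀ {u} → u ∈ us → u ∈ fixed × InImage dilate fixed fixed! a (dilate a u)) →
    length us ≤ n * (n * n) * 2
  few-collisions {n} {a} {us} n<p a<n us! collides = begin
    length us             ≤⟨ length≤fibres root? codes us us! covered fibres ⟩
    length codes * 2      ≡⟨ cong (_* 2) codes-length ⟩
    a * (n * n) * 2       ≤⟨ *-monoˡ-≤ 2 (*-monoˡ-≤ (n * n) (<⇒≤ a<n)) ⟩
    n * (n * n) * 2       ∎
    where
    open ≤-Reasoning
    codes : List (ℕ × ℕ × ℕ)
    codes = cartesianProduct (upTo a) (cartesianProduct (upTo n) (upTo n))
    codes-length : length codes ≡ a * (n * n)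
    codes-length = trans (length-cartesianProduct (upTo a) _) (cong₂ _*_ (length-upTo a)
      (trans (length-cartesianProduct (upTo n) (upTo n)) (cong₂ _*_ (length-upTo n) (length-upTo n))))
    root? : ∀ c → Decidable (collisionRoot a c)
    root? (b , i , j) u = pos p ℤ∣.∣? _
    -- As u < p, the quotient of (b + 1) u by `p` is below b + 1 ≤ n; this keeps the number of
    -- labels independent of `p`.
    quotient< : ∀ {b u} → b < n → u < p → suc b * u / p < n
    quotient< {b} {u} b<n u<p = m<n*o⇒m/o<n (<-≤-trans (*-monoʳ-< (suc b) u<p) (*-monoˡ-≤ p b<n))
    covered : ∀ {u} → u ∈ us → ∃[ c ] c ∈ codes × collisionRoot a c u
    covered {u} u∈ with collides u∈
    ... | u∈F , b , b<a , v , v∈F , eq =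
      (b , suc a * u / p , suc b * v / p)
      , ∈-cartesianProduct⁺ (∈-upTo⁺ b<a) (∈-cartesianProduct⁺
          (∈-upTo⁺ (quotient< a<n (fixed⇒< u∈F))) (∈-upTo⁺ (quotient< (<-trans b<a a<n) (fixed⇒< v∈F))))
      , collision pr {u = u} {v = v} {r = dilate a u}
          (proj₂ (fermat pr (suc a))) (proj₂ (fermat pr (suc b)))
          (proj₂ (fixed⇒power u∈F)) (proj₂ (fixed⇒power v∈F))
          (dilate-division a u)
          (subst (λ r → suc b * v ≡ r + p * (suc b * v / p)) (sym eq) (dilate-division b v))
    fibres : ∀ {c} → c ∈ codes → NoThreeDistinct (λ u → u ∈ us × collisionRoot a c u)
    fibres {b , i , j} c∈ (u∈ , du) (v∈ , dv) (w∈ , dw) = no-three-roots pr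
      (middle (suc a) (suc b)) (pos (suc b) ℤ.* (pos i ℤ.- pos j))
      (p∤leading pr (s≤s z≤n) (≤-<-trans a<n n<p) (≤-<-trans (<-trans b<a a<n) n<p) (>⇒≢ (s≤s b<a)))
      (fixed⇒< (proj₁ (collides u∈))) (fixed⇒< (proj₁ (collides v∈))) (fixed⇒< (proj₁ (collides w∈))) du dv dw
      where
      b<a : b < a
      b<a = ∈-upTo⁻ (proj₁ (∈-cartesianProduct⁻ (upTo a) _ c∈))

  -- The union of the `n` dilates consists of residues modulo `p`, and each dilate loses at most 2n³
  -- elements to the earlier ones.
  dilates-bound : ∀ {n} → n < p → n * fixedPoints p ≤ p * 2 + n * (n * (n * n) * 2)
  dilates-bound {n} n<p =
    let U , U! , U⊆ , bound = union-of-images dilate fixed fixed! (n * (n * n) * 2) n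
          (λ a<n u∈ v∈ → dilate-injective (≤-<-trans a<n n<p) (fixed⇒< u∈) (fixed⇒< v∈))
          (few-collisions n<p)
    in ≤-trans bound (+-monoˡ-≤ _ (length≤2n U! λ r∈ → small (U⊆ r∈)))
    where
    small : ∀ {r} → InImage dilate fixed fixed! n r → r < p
    small (b , _ , v , _ , refl) = m%n<n (suc b * v) p

-- Choice of the number of dilates and final exponents

-- Supplies n ≈ p^(1/4), the choice that balances 2p against 2n⁴.
fourth-root : ∀ n → ∃[ a ] a ^ 4 ≤ n × n < suc a ^ 4
fourth-root zero = 0 , z≤n , s≤s z≤n
fourth-root (suc n) with fourth-root n
... | a , lo , hi with suc a ^ 4 ≤? suc n
...   | no ≰  = a , m≤n⇒m≤1+n lo , ≰⇒> ≰
...   | yes ≤ = suc a , ≤ , ≤-<-trans hi (^-monoˡ-< 4 (n<1+n (suc a)))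

-- From n⁴ ≤ p follows n F ≤ 4p, and F ≤ n F then gives (n + 1) F ≤ 8p. Since p < (n + 1)⁴, fourth
-- powers yield p F⁴ ≤ (8p)⁴, with 8⁴ = 4096.
quartic-arithmetic : ∀ {p n F} .{{_ : NonZero p}} .{{_ : NonZero n}} → n ^ 4 ≤ p → p < suc n ^ 4 →
  n * F ≤ p * 2 + n * (n * (n * n) * 2) → F ^ 4 ≤ p ^ 3 * 4096
quartic-arithmetic {p} {n} {F} lo hi bound = *-cancelˡ-≤ p (begin
  p * F ^ 4             ≤⟨ *-monoˡ-≤ (F ^ 4) (<⇒≤ hi) ⟩
  suc n ^ 4 * F ^ 4     ≡⟨ *-^-distrib (suc n) F 4 ⟨
  (suc n * F) ^ 4       ≤⟨ ^-monoˡ-≤ 4 (+-mono-≤ (≤-trans (m≤n*m F n) nF≤4p) nF≤4p) ⟩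
  (p * 4 + p * 4) ^ 4   ≡⟨ cong (_^ 4) (*-distribˡ-+ p 4 4) ⟨
  (p * 8) ^ 4           ≡⟨ *-^-distrib p 8 4 ⟩
  p ^ 4 * 4096          ≡⟨ *-assoc p (p ^ 3) 4096 ⟩
  p * (p ^ 3 * 4096)    ∎)
  where
  open ≤-Reasoning
  quartic : ∀ n → n * (n * (n * n) * 2) ≡ n * (n * (n * (n * 1))) * 2
  quartic = solve-∀
  nF≤4p : n * F ≤ p * 4
  nF≤4p = begin
    n * F                           ≤⟨ bound ⟩
    p * 2 + n * (n * (n * n) * 2)   ≡⟨ cong (λ z → p * 2 + z) (quartic n) ⟩
    p * 2 + n ^ 4 * 2               ≤⟨ +-monoʳ-≤ (p * 2) (*-monoˡ-≤ 2 lo) ⟩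
    p * 2 + p * 2                   ≡⟨ *-distribˡ-+ p 2 2 ⟨
    p * 4                           ∎

fourth-power-bound : ∀ {p} → Prime p → fixedPoints p ^ 4 ≤ p ^ 3 * 4096
fourth-power-bound {p} pr = from-root (fourth-root p)
  where
  instance _ = prime⇒nonZero pr
  1<p : 1 < p
  1<p = nonTrivial⇒n>1 p {{prime⇒nonTrivial pr}}
  n<p : ∀ {n} → n ^ 4 ≤ p → n < p
  n<p {n} lo = ≰⇒> λ p≤n → <-irrefl refl (begin-strict
    p       ≡⟨ ^-identityʳ p ⟨
    p ^ 1   <⟨ ^-monoʳ-< p 1<p {1} {4} (s≤s (s≤s z≤n)) ⟩
    p ^ 4   ≤⟨ ^-monoˡ-≤ 4 p≤n ⟩
    n ^ 4   ≤⟨ lo ⟩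
    p       ∎)
    where open ≤-Reasoning
  from-root : ∃[ n ] n ^ 4 ≤ p × p < suc n ^ 4 → fixedPoints p ^ 4 ≤ p ^ 3 * 4096
  from-root (zero  , _  , p<1) = contradiction p<1 (<-asym 1<p)
  from-root (suc n , lo , hi)  = quartic-arithmetic {n = suc n} lo hi (dilates-bound pr (n<p {suc n} lo))

-- Cubing the fourth-power bound produces the constant 4096³ = 2³⁶ = 262144², which two factors `p`
-- absorb once `p` reaches 2¹⁸ = 262144.
twelfth-power-bound : ∀ {p} → Prime p → 262144 ≤ p → fixedPoints p ^ 12 ≤ p ^ 11
twelfth-power-bound {p} pr big = begin
  fixedPoints p ^ 12         ≡⟨ ^-*-assoc (fixedPoints p) 4 3 ⟨
  (fixedPoints p ^ 4) ^ 3    ≤⟨ ^-monoˡ-≤ 3 (fourth-power-bound pr) ⟩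
  (p ^ 3 * 4096) ^ 3         ≡⟨ *-^-distrib (p ^ 3) 4096 3 ⟩
  (p ^ 3) ^ 3 * 262144 ^ 2   ≡⟨ cong (_* 262144 ^ 2) (^-*-assoc p 3 3) ⟩
  p ^ 9 * 262144 ^ 2         ≤⟨ *-monoʳ-≤ (p ^ 9) (^-monoˡ-≤ 2 big) ⟩
  p ^ 9 * p ^ 2              ≡⟨ ^-distribˡ-+-* p 9 2 ⟨
  p ^ 11                     ∎
  where open ≤-Reasoning

-- Taking roots of order 12 (k + 1), the inequality reads F(p) ≤ p^(11/12 + 1/(k+1)); having it for
-- every `k` and all large `p` expresses the o(1) without real exponents.
theorem8 : (k : ℕ) → ∃[ P ] ((p : ℕ) → Prime p → P ≤ p →
    fixedPoints p ^ (12 * suc k) ≤ p ^ (11 * suc k + 12))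
theorem8 k = 262144 , λ p pr big → begin
  fixedPoints p ^ (12 * suc k)   ≡⟨ ^-*-assoc (fixedPoints p) 12 (suc k) ⟨
  (fixedPoints p ^ 12) ^ suc k   ≤⟨ ^-monoˡ-≤ (suc k) (twelfth-power-bound pr big) ⟩
  (p ^ 11) ^ suc k               ≡⟨ ^-*-assoc p 11 (suc k) ⟩
  p ^ (11 * suc k)               ≤⟨ ^-monoʳ-≤ p {{prime⇒nonZero pr}} (m≤m+n (11 * suc k) 12) ⟩
  p ^ (11 * suc k + 12)          ∎
  where open ≤-Reasoning
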